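{- For any circle graph $G$ on $n \ge 3$ vertices, $\psi(G) \le \lceil n/2 \rceil$.
   Context: A circle graph is the intersection graph of a finite set of chords of a circle. For $k \ge 3$, a $k$-polygon graph is the intersection graph of a finite set of chords of a convex $k$-sided polygon with each chord having its endpoints on two distinct sides; $2$-polygon graphs are the permutation graphs. The polygon number $\psi(G)$ of a circle graph $G$ is the minimum $k\ge 2$ such that $G$ is a $k$-polygon graph. -}

module Defs where

open import Data.Nat using (ℕ; _<_; _≤_; ⌈_/2⌉)
open import Data.Fin using (Fin; toℕ)
open import Data.Product using (Σ; _×_)
open import Data.Sum using (_⊎_)
open import Relation.Nullary using (¬_)
open import Relation.Binary.PropositionalEquality using (_≡_; _≢_)

record Graph (n : ℕ) : Set₁ where
  field
    Adj    : Fin n → Fin n → Set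
    sym    : ∀ {i j} → Adj i j → Adj j i
    irrefl : ∀ i → ¬ Adj i i
open Graph public

-- A chord diagram with n chords: the boundary of the circle (or polygon),
-- cut open at some point, is identified with the order of ℕ; chord i has
-- endpoints left i < right i, and all 2n endpoints are pairwise distinct.
record ChordModel (n : ℕ) : Set where
  field
    left      : Fin n → ℕ
    right     : Fin n → ℕ
    left<right : ∀ i → left i < right i
    distinct  : ∀ i j → i ≢ j →
                (left i ≢ left j) × (right i ≢ right j) × (left i ≢ right j)
open ChordModel public

Cross : ∀ {n} → ChordModel n → Fin n → Fin n → Set
Cross M i j =
    (left M i < left M j × left M j < right M i × right M i < right M j)
  ⊎ (left M j < left M i × left M i < right M j × right M j < right M i)

Represents : ∀ {n} → Graph n → ChordModel n → Set
Represents G M = ∀ i j → i ≢ j →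
  (Adj G i j → Cross M i j) × (Cross M i j → Adj G i j)

IsCircleGraph : ∀ {n} → Graph n → Set
IsCircleGraph {n} G = Σ (ChordModel n) (Represents G)

-- G is a k-polygon graph: a chord model whose boundary is divided into k
-- consecutive arcs (the sides; side : ℕ → Fin k monotone), such that the
-- two endpoints of every chord lie on distinct sides.
-- For k = 2 this is exactly the class of permutation graphs.
IsPolygonGraph : ∀ {n} → ℕ → Graph n → Set
IsPolygonGraph {n} k G =
  Σ (ChordModel n) λ M → Represents G M ×
  Σ (ℕ → Fin k) λ side →
    (∀ {x y} → x ≤ y → toℕ (side x) ≤ toℕ (side y)) ×
    (∀ i → side (left M i) ≢ side (right M i))

PolygonNumber≤ : ∀ {n} → Graph n → ℕ → Set
PolygonNumber≤ G m = Σ ℕ λ k → (2 ≤ k) × (k ≤ m) × IsPolygonGraph k G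

{-# OPTIONS --safe #-}
module Submission where

-- View the chords of a model as intervals, and let o be the chord whose left
-- end comes first. A cut is a point between two ends; k sides are the
-- wrap-around point together with k − 1 cuts, and a chord is fine as soon as its
-- interval contains a cut. A leaf (a vertex with a single neighbour w) may be
-- redrawn around either end of w, so one cut at that end serves w and all its
-- leaves; the wrap-around point does the same for o and isolated vertices.
-- Orient all hubs w ≠ o of leaves to the left, or all to the right. The plain
-- intervals missed by the hub cuts are pierced greedily, which yields pairwise
-- disjoint families S and S′ of plain chords and as many additional cuts. A
-- chord in S ∩ S′ crosses no hub, as some end of the hub would lie in its interval.
-- Counting the ends inside the intervals of S ∩ S′ gives
-- |S ∩ S′| ≤ |plain chords outside S ∪ S′|, hence |S| + |S′| ≤ |plain chords|.
-- Therefore the two orientations use at most n − 1 cuts together, and one of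
-- them at most ⌈n/2⌉ − 1.

open import Defs
open import Data.Nat using (ℕ; _≤_; ⌈_/2⌉)
open import Data.Nat using (zero; suc; _+_; _*_; _∸_; _<_; ⌊_/2⌋; z≤n; s≤s; _<?_; _≤?_; _≟_)
open import Data.Nat.Properties hiding (_≟_; _<?_; _≤?_)
open import Data.Nat.Tactic.RingSolver using (solve-∀)
open import Data.Bool using (Bool; true; false; if_then_else_)
open import Data.Fin using (Fin; zero; suc; toℕ; fromℕ<)
open import Data.Fin.Properties using (any?; all?; toℕ<n; toℕ-fromℕ<; toℕ-injective) renaming (_≟_ to _≟ᶠ_)
open import Data.Product using (∃; _×_; _,_; proj₁; proj₂)
open import Data.Sum using (_⊎_; inj₁; inj₂; swap)
open import Function using (_∘_; case_of_)
open import Relation.Binary.Definitions using (tri<; tri≈; tri>)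
open import Relation.Binary.PropositionalEquality
  using (_≡_; _≢_; refl; trans; cong; cong₂; subst; ≢-sym)
  renaming (sym to ≡-sym)
open import Relation.Nullary using (¬_; Dec; does; yes; no; contradiction)
open import Relation.Nullary.Decidable using (_×-dec_; _⊎-dec_; _→-dec_; ¬?; dec-true; dec-false)
open import Relation.Unary using (Decidable)
open import Algebra.Properties.CommutativeMonoid.Sum +-0-commutativeMonoid
  using (sum; ∑-comm; ∑-distrib-+)

private variable
  n : ℕ

-- Indicator sums and double counting.

𝟙 : {P : Set} → Dec P → ℕ
𝟙 (yes _) = 1
𝟙 (no _)  = 0

𝟙-yes : {P : Set} (d : Dec P) → P → 𝟙 d ≡ 1
𝟙-yes (yes _) _ = refl
𝟙-yes (no ¬p) p = contradiction p ¬p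

𝟙-no : {P : Set} (d : Dec P) → ¬ P → 𝟙 d ≡ 0
𝟙-no (yes p) ¬p = contradiction p ¬p
𝟙-no (no _)  _  = refl

𝟙-mono : {P Q : Set} (d : Dec P) (e : Dec Q) → (P → Q) → 𝟙 d ≤ 𝟙 e
𝟙-mono (yes p) e f = ≤-reflexive (≡-sym (𝟙-yes e (f p)))
𝟙-mono (no _)  e f = z≤n

sum-mono : {f g : Fin n → ℕ} → (∀ i → f i ≤ g i) → sum f ≤ sum g
sum-mono {zero}  f≤g = z≤n
sum-mono {suc n} f≤g = +-mono-≤ (f≤g zero) (sum-mono (f≤g ∘ suc))

sum-mono-< : {f g : Fin n → ℕ} → (∀ i → f i ≤ g i) → ∀ k → f k < g k → sum f < sum g
sum-mono-< f≤g zero    f<g = +-mono-<-≤ f<g (sum-mono (f≤g ∘ suc))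
sum-mono-< f≤g (suc k) f<g = +-mono-≤-< (f≤g zero) (sum-mono-< (f≤g ∘ suc) k f<g)

sum-zero : {f : Fin n → ℕ} → (∀ i → f i ≡ 0) → sum f ≡ 0
sum-zero {zero}  f≡0 = refl
sum-zero {suc n} f≡0 = cong₂ _+_ (f≡0 zero) (sum-zero (f≡0 ∘ suc))

sum-≤1⇒≤n : {f : Fin n → ℕ} → (∀ i → f i ≤ 1) → sum f ≤ n
sum-≤1⇒≤n {zero}  f≤1 = z≤n
sum-≤1⇒≤n {suc n} f≤1 = +-mono-≤ (f≤1 zero) (sum-≤1⇒≤n (f≤1 ∘ suc))

term≤sum : (f : Fin n → ℕ) → ∀ k → f k ≤ sum f
term≤sum f zero    = m≤m+n _ _
term≤sum f (suc k) = ≤-trans (term≤sum (f ∘ suc) k) (m≤n+m _ _)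

terms≤sum : (f : Fin n → ℕ) → ∀ {j k} → j ≢ k → f j + f k ≤ sum f
terms≤sum f {zero}  {zero}  j≢k = contradiction refl j≢k
terms≤sum f {zero}  {suc k} j≢k = +-monoʳ-≤ (f zero) (term≤sum (f ∘ suc) k)
terms≤sum f {suc j} {zero}  j≢k =
  ≤-trans (≤-reflexive (+-comm (f (suc j)) (f zero))) (+-monoʳ-≤ (f zero) (term≤sum (f ∘ suc) j))
terms≤sum f {suc j} {suc k} j≢k =
  ≤-trans (terms≤sum (f ∘ suc) (j≢k ∘ cong suc)) (m≤n+m _ _)

sum-𝟙-unique : {P : Fin n → Set} (P? : Decidable P) →
               (∀ i j → P i → P j → i ≡ j) → sum (λ i → 𝟙 (P? i)) ≤ 1
sum-𝟙-unique {zero}  P? unique = z≤n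
sum-𝟙-unique {suc n} P? unique with P? zero
... | yes p = s≤s (≤-reflexive (sum-zero λ i →
                𝟙-no (P? (suc i)) λ q → case unique zero (suc i) p q of λ ()))
... | no _  = sum-𝟙-unique (P? ∘ suc) λ i j p q → case unique (suc i) (suc j) p q of λ where refl → refl

double-count : {f g : Fin n → ℕ} (h : Fin n → Fin n → ℕ) →
               (∀ i → f i ≤ sum (h i)) → (∀ j → sum (λ i → h i j) ≤ g j) → sum f ≤ sum g
double-count {f = f} {g} h f≤ ≤g = begin
  sum f                          ≤⟨ sum-mono f≤ ⟩
  sum (λ i → sum (h i))          ≡⟨ ∑-comm h ⟩
  sum (λ j → sum (λ i → h i j))  ≤⟨ sum-mono ≤g ⟩
  sum g                          ∎
  where open ≤-Reasoning

argmin : (f : Fin (suc n) → ℕ) → ∃ λ o → ∀ i → f o ≤ f i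
argmin {zero}  f = zero , λ where zero → ≤-refl
argmin {suc n} f with argmin (f ∘ suc)
... | o , min with f zero ≤? f (suc o)
...   | yes f₀≤ = zero , λ where
          zero    → ≤-refl
          (suc i) → ≤-trans f₀≤ (min i)
...   | no f₀≰  = suc o , λ where
          zero    → <⇒≤ (≰⇒> f₀≰)
          (suc i) → min i

-- Piercing of intervals.

-- Greedy piercing by right end points: an interval not yet pierced when its
-- right end is reached joins the chosen family.
module _ (l r : Fin n → ℕ) {P : Fin n → Set} (P? : Decidable P) where

  -- The family pierces at the right ends `r a` of its members. The index `k` is the position of the
  -- sweep: only intervals with right end below `k` are dealt with. The bound `r a ≤ r x` puts the
  -- piercing point inside `x` or at its end.
  record Piercing (k : ℕ) : Set₁ where
    field
      Chosen   : Fin n → Set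
      chosen?  : Decidable Chosen
      chosen⊆  : ∀ {a} → Chosen a → P a × r a < k
      disjoint : ∀ {a b} → Chosen a → Chosen b → a ≢ b → r a ≤ l b ⊎ r b ≤ l a
      pierced  : ∀ {x} → P x → r x < k → ∃ λ a → Chosen a × l x < r a × r a ≤ r x

  pierce : (∀ i → l i < r i) → ∀ k → Piercing k
  pierce l<r zero = record
    { Chosen   = λ i → i ≢ i
    ; chosen?  = λ i → no λ i≢i → i≢i refl
    ; chosen⊆  = λ i≢i → contradiction refl i≢i
    ; disjoint = λ i≢i → contradiction refl i≢i
    ; pierced  = λ _ ()
    }
  pierce l<r (suc k) with pierce l<r k
  ... | S with any? (λ x → P? x ×-dec (r x ≟ k) ×-dec
                         ¬? (any? λ a → Piercing.chosen? S a ×-dec (l x <? r a)))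
  ...   | no ∄x = record
    { Chosen   = Chosen
    ; chosen?  = chosen?
    ; chosen⊆  = λ c → proj₁ (chosen⊆ c) , m<n⇒m<1+n (proj₂ (chosen⊆ c))
    ; disjoint = disjoint
    ; pierced  = pierced′
    }
    where
    open Piercing S
    pierced′ : ∀ {x} → P x → r x < suc k → ∃ λ a → Chosen a × l x < r a × r a ≤ r x
    pierced′ {x} p rx<1+k with m<1+n⇒m<n∨m≡n rx<1+k
    ... | inj₁ rx<k = pierced p rx<k
    ... | inj₂ refl with any? (λ a → chosen? a ×-dec (l x <? r a))
    ...   | yes (a , c , lx<ra) = a , c , lx<ra , <⇒≤ (proj₂ (chosen⊆ c))
    ...   | no ∄a               = contradiction (x , p , refl , ∄a) ∄x
  ...   | yes (y , py , refl , ∄a) = record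
    { Chosen   = λ a → Chosen a ⊎ a ≡ y
    ; chosen?  = λ a → chosen? a ⊎-dec (a ≟ᶠ y)
    ; chosen⊆  = λ where
        (inj₁ c)    → proj₁ (chosen⊆ c) , m<n⇒m<1+n (proj₂ (chosen⊆ c))
        (inj₂ refl) → py , ≤-refl
    ; disjoint = λ where
        (inj₁ c)    (inj₁ d)    a≢b → disjoint c d a≢b
        -- `y` is unpierced, so every earlier member ends at or before its left end.
        (inj₁ c)    (inj₂ refl) _   → inj₁ (≮⇒≥ λ ly<ra → ∄a (_ , c , ly<ra))
        (inj₂ refl) (inj₁ c)    _   → inj₂ (≮⇒≥ λ ly<ra → ∄a (_ , c , ly<ra))
        (inj₂ refl) (inj₂ refl) a≢b → contradiction refl a≢b
    ; pierced  = pierced′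
    }
    where
    open Piercing S
    pierced′ : ∀ {x} → P x → r x < suc (r y) →
               ∃ λ a → (Chosen a ⊎ a ≡ y) × l x < r a × r a ≤ r x
    pierced′ {x} p rx<1+k with m<1+n⇒m<n∨m≡n rx<1+k
    -- An interval ending together with `y` is pierced at that common end.
    ... | inj₂ rx≡ = y , inj₂ refl , subst (l x <_) rx≡ (l<r x) , ≤-reflexive (≡-sym rx≡)
    ... | inj₁ rx<k with pierced p rx<k
    ...   | a , c , h = a , inj₁ c , h

-- Relative position of two chords.

-- The order of two chords (a , b) and (c , d), together with whether P, the
-- crossing of the chords they stand for, holds.
data Placed (a b c d : ℕ) (P : Set) : Set where
  before  : b < c → ¬ P → Placed a b c d P
  after   : d < a → ¬ P → Placed a b c d P
  outside : a < c → d < b → ¬ P → Placed a b c d P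
  inside  : c < a → b < d → ¬ P → Placed a b c d P
  crossₗ  : a < c → c < b → b < d → P → Placed a b c d P
  crossᵣ  : c < a → a < d → d < b → P → Placed a b c d P

Placed-sym : ∀ {a b c d} {P Q : Set} → (P → Q) → (Q → P) → Placed a b c d P → Placed c d a b Q
Placed-sym f g (before x ¬p)    = after x (¬p ∘ g)
Placed-sym f g (after x ¬p)     = before x (¬p ∘ g)
Placed-sym f g (outside x y ¬p) = inside x y (¬p ∘ g)
Placed-sym f g (inside x y ¬p)  = outside x y (¬p ∘ g)
Placed-sym f g (crossₗ x y z p) = crossᵣ x y z (f p)
Placed-sym f g (crossᵣ x y z p) = crossₗ x y z (f p)

module _ {a b c d : ℕ} {P : Set} (a<b : a < b) (c<d : c < d) where

  -- These are the three inequalities in `distinct`; the fourth, `b ≢ c`, is `a ≢ d` with the two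
  -- chords exchanged.
  Placed⇒distinct : Placed a b c d P → (a ≢ c) × (b ≢ d) × (a ≢ d)
  Placed⇒distinct (before b<c _) =
    <⇒≢ (<-trans a<b b<c) , <⇒≢ (<-trans b<c c<d) , <⇒≢ (<-trans a<b (<-trans b<c c<d))
  Placed⇒distinct (after d<a _) =
    >⇒≢ (<-trans c<d d<a) , >⇒≢ (<-trans d<a a<b) , >⇒≢ d<a
  Placed⇒distinct (outside a<c d<b _) = <⇒≢ a<c , >⇒≢ d<b , <⇒≢ (<-trans a<c c<d)
  Placed⇒distinct (inside c<a b<d _) = >⇒≢ c<a , <⇒≢ b<d , <⇒≢ (<-trans a<b b<d)
  Placed⇒distinct (crossₗ a<c c<b b<d _) = <⇒≢ a<c , <⇒≢ b<d , <⇒≢ (<-trans a<b b<d)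
  Placed⇒distinct (crossᵣ c<a a<d d<b _) = >⇒≢ c<a , >⇒≢ d<b , <⇒≢ a<d

  Placed⇒cross : Placed a b c d P → P → (a < c × c < b × b < d) ⊎ (c < a × a < d × d < b)
  Placed⇒cross (before _ ¬p)    p = contradiction p ¬p
  Placed⇒cross (after _ ¬p)     p = contradiction p ¬p
  Placed⇒cross (outside _ _ ¬p) p = contradiction p ¬p
  Placed⇒cross (inside _ _ ¬p)  p = contradiction p ¬p
  Placed⇒cross (crossₗ x y z _) p = inj₁ (x , y , z)
  Placed⇒cross (crossᵣ x y z _) p = inj₂ (x , y , z)

  cross⇒Placed : Placed a b c d P → (a < c × c < b × b < d) ⊎ (c < a × a < d × d < b) → P
  cross⇒Placed (before b<c _) (inj₁ (_ , c<b , _)) = contradiction c<b (<-asym b<c)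
  cross⇒Placed (before b<c _) (inj₂ (c<a , _)) = contradiction c<a (<-asym (<-trans a<b b<c))
  cross⇒Placed (after d<a _) (inj₁ (a<c , _)) = contradiction a<c (<-asym (<-trans c<d d<a))
  cross⇒Placed (after d<a _) (inj₂ (_ , a<d , _)) = contradiction a<d (<-asym d<a)
  cross⇒Placed (outside _ d<b _) (inj₁ (_ , _ , b<d)) = contradiction b<d (<-asym d<b)
  cross⇒Placed (outside a<c _ _) (inj₂ (c<a , _)) = contradiction c<a (<-asym a<c)
  cross⇒Placed (inside c<a _ _) (inj₁ (a<c , _)) = contradiction a<c (<-asym c<a)
  cross⇒Placed (inside _ b<d _) (inj₂ (_ , _ , d<b)) = contradiction d<b (<-asym b<d)
  cross⇒Placed (crossₗ _ _ _ p) _ = p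
  cross⇒Placed (crossᵣ _ _ _ p) _ = p

-- Hubs, leaves and plain chords.

module Chords (M : ChordModel n) (o : Fin n) (o-first : ∀ {i} → i ≢ o → left M o < left M i) where

  private
    l r : Fin n → ℕ
    l = left M
    r = right M

  Within : Fin n → ℕ → Set
  Within i e = l i < e × e < r i

  abstract
    within? : ∀ i e → Dec (Within i e)
    within? i e = (l i <? e) ×-dec (e <? r i)

  abstract
    cross? : ∀ i j → Dec (Cross M i j)
    cross? i j = ((l i <? l j) ×-dec (l j <? r i) ×-dec (r i <? r j))
           ⊎-dec ((l j <? l i) ×-dec (l i <? r j) ×-dec (r j <? r i))

  cross⇒≢ : ∀ {i j} → Cross M i j → i ≢ j
  cross⇒≢ (inj₁ (li<lj , _)) refl = <-irrefl refl li<lj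
  cross⇒≢ (inj₂ (lj<li , _)) refl = <-irrefl refl lj<li

  cross⇒end-within : ∀ {i j} → Cross M i j → Within i (l j) ⊎ Within i (r j)
  cross⇒end-within (inj₁ (x , y , _)) = inj₁ (x , y)
  cross⇒end-within (inj₂ (_ , x , y)) = inj₂ (x , y)

  Pendant : Fin n → Fin n → Set
  Pendant i w = Cross M i w × (∀ j → Cross M i j → j ≡ w)

  Branching : Fin n → Set
  Branching i = ∃ λ j → ∃ λ k → j ≢ k × Cross M i j × Cross M i k

  abstract
    branching? : Decidable Branching
    branching? i = any? λ j → any? λ k → ¬? (j ≟ᶠ k) ×-dec cross? i j ×-dec cross? i k

  pendant⇒¬branching : ∀ {i w} → Pendant i w → ¬ Branching i
  pendant⇒¬branching (_ , only) (j , k , j≢k , cj , ck) = j≢k (trans (only j cj) (≡-sym (only k ck)))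

  ¬branching⇒pendant : ∀ {i j} → ¬ Branching i → Cross M i j → Pendant i j
  ¬branching⇒pendant {i} {j} ¬b c = c , λ k c′ → case k ≟ᶠ j of λ where
    (yes k≡j) → k≡j
    (no k≢j)  → contradiction (k , j , k≢j , c′ , c) ¬b

  -- The last component decides which end of an isolated edge is the leaf.
  Leaf : Fin n → Fin n → Set
  Leaf p w = p ≢ o × Pendant p w × (Branching w ⊎ l w < l p)

  abstract
    leaf? : ∀ p w → Dec (Leaf p w)
    leaf? p w = ¬? (p ≟ᶠ o) ×-dec (cross? p w ×-dec all? λ j → cross? p j →-dec (j ≟ᶠ w))
                ×-dec (branching? w ⊎-dec (l w <? l p))

  Hub : Fin n → Set
  Hub w = w ≢ o × ∃ λ p → Leaf p w

  abstract
    hub? : Decidable Hub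
    hub? w = ¬? (w ≟ᶠ o) ×-dec any? λ p → leaf? p w

  Plain : Fin n → Set
  Plain i = i ≢ o × Branching i × ¬ Hub i

  abstract
    plain? : Decidable Plain
    plain? i = ¬? (i ≟ᶠ o) ×-dec branching? i ×-dec ¬? (hub? i)

  -- A leaf `q` of `p` must be `w`, the only neighbour of `p`. Then `p` and `w` have no other
  -- neighbours, and comparing left ends cannot declare both of them leaves.
  leaf⇒¬hub : ∀ {p w} → Leaf p w → ¬ Hub p
  leaf⇒¬hub {p} {w} (_ , pend@(_ , only) , b) (_ , q , _ , pend′ , b′)
    with only q (swap (proj₁ pend′))
  ... | refl with b | b′
  ...   | inj₁ bw   | _          = pendant⇒¬branching pend′ bw
  ...   | inj₂ _    | inj₁ bp    = pendant⇒¬branching pend bp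
  ...   | inj₂ w<p  | inj₂ p<w   = <-asym w<p p<w

  -- The role of a chord determines how it is redrawn. Petals are the leaves of `o`; core chords are
  -- those that keep both of their ends.
  data Role (i : Fin n) : Set where
    root  : i ≡ o → Role i
    iso   : i ≢ o → (∀ j → ¬ Cross M i j) → Role i
    petal : Leaf i o → Role i
    leaf  : ∀ w → w ≢ o → Leaf i w → Role i
    core  : i ≢ o → Plain i ⊎ Hub i → Role i

  role-leaf : ∀ {i} w → Leaf i w → Role i
  role-leaf w lf with w ≟ᶠ o
  ... | yes refl = petal lf
  ... | no w≢o   = leaf w w≢o lf

  role : ∀ i → Role i
  role i with i ≟ᶠ o
  ... | yes i≡o = root i≡o
  ... | no i≢o with any? (cross? i)
  ...   | no ∄j = iso i≢o λ j c → ∄j (j , c)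
  ...   | yes (w , c) with branching? i
  ...     | yes b with hub? i
  ...       | yes h = core i≢o (inj₂ h)
  ...       | no ¬h = core i≢o (inj₁ (i≢o , b , ¬h))
  role i | no i≢o | yes (w , c) | no ¬b with branching? w
  ...       | yes b′ = role-leaf w (i≢o , ¬branching⇒pendant ¬b c , inj₁ b′)
  -- Neither `i` nor `w` branches, so they form an isolated edge, in which the chord with the larger
  -- left end becomes the leaf.
  ...       | no ¬b′ with <-cmp (l w) (l i)
  ...         | tri< w<i _ _ = role-leaf w (i≢o , ¬branching⇒pendant ¬b c , inj₂ w<i)
  ...         | tri≈ _ w≡i _ = contradiction w≡i (proj₁ (distinct M w i (≢-sym (cross⇒≢ c))))
  ...         | tri> _ _ i<w = core i≢o (inj₂ (i≢o , w , w≢o , ¬branching⇒pendant ¬b′ (swap c) , inj₂ i<w))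
    where
    w≢o : w ≢ o
    w≢o refl = <-asym i<w (o-first i≢o)

  -- A neighbour that is a leaf or a petal has `i` as its only neighbour, which would make `i` a hub
  -- or equal to `o`.
  plain-neighbour : ∀ {i j} → Plain i → Cross M i j → j ≡ o ⊎ Plain j ⊎ Hub j
  plain-neighbour {i} {j} (i≢o , _ , ¬h) c with role j
  ... | root j≡o              = inj₁ j≡o
  ... | iso _ alone           = contradiction (swap c) (alone i)
  ... | petal (_ , (_ , only) , _) = contradiction (only i (swap c)) i≢o
  ... | leaf w w≢o lf@(_ , (_ , only) , _) with only i (swap c)
  ...   | refl = contradiction (w≢o , j , lf) ¬h
  plain-neighbour _ _ | core _ x = inj₂ x

  -- Counting the chosen chords.

  -- Orienting every hub towards its left end, or towards its right end, leaves
  -- these chords without a cut.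
  Missed : (Fin n → ℕ) → Fin n → Set
  Missed e x = Plain x × ¬ (∃ λ w → Hub w × Within x (e w))

  abstract
    missed? : ∀ e → Decidable (Missed e)
    missed? e x = plain? x ×-dec ¬? (any? λ w → hub? w ×-dec within? x (e w))

  module _ {k k′} (S : Piercing l r (missed? l) k) (S′ : Piercing l r (missed? r) k′) where
    open Piercing S  using (Chosen; chosen?; chosen⊆; disjoint)
    open Piercing S′ using () renaming (Chosen to Chosen′; chosen? to chosen′?; chosen⊆ to chosen′⊆)

    Both : Fin n → Set
    Both a = Chosen a × Chosen′ a

    both? : Decidable Both
    both? a = chosen? a ×-dec chosen′? a

    Neither : Fin n → Set
    Neither b = Plain b × ¬ Chosen b × ¬ Chosen′ b

    neither? : Decidable Neither
    neither? b = plain? b ×-dec ¬? (chosen? b) ×-dec ¬? (chosen′? b)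

    chosen-unique : ∀ {a b e} → Chosen a → Chosen b → Within a e → Within b e → a ≡ b
    chosen-unique {a} {b} ca cb (la<e , e<ra) (lb<e , e<rb) with a ≟ᶠ b
    ... | yes a≡b = a≡b
    ... | no a≢b with disjoint ca cb a≢b
    ...   | inj₁ ra≤lb = contradiction (<-trans e<ra (≤-<-trans ra≤lb lb<e)) (<-irrefl refl)
    ...   | inj₂ rb≤la = contradiction (<-trans e<rb (≤-<-trans rb≤la la<e)) (<-irrefl refl)

    disjoint⇒¬cross : ∀ {a b} → r a ≤ l b ⊎ r b ≤ l a → ¬ Cross M a b
    disjoint⇒¬cross (inj₁ ra≤lb) (inj₁ (_ , lb<ra , _)) = <⇒≱ lb<ra ra≤lb
    disjoint⇒¬cross (inj₁ ra≤lb) (inj₂ (lb<la , _)) =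
      <⇒≱ (<-trans lb<la (left<right M _)) ra≤lb
    disjoint⇒¬cross (inj₂ rb≤la) (inj₁ (la<lb , _)) =
      <⇒≱ (<-trans la<lb (left<right M _)) rb≤la
    disjoint⇒¬cross (inj₂ rb≤la) (inj₂ (_ , la<rb , _)) = <⇒≱ la<rb rb≤la

    -- A plain neighbour in `S` or `S′` would contradict disjointness. A crossing hub would have one
    -- end inside the interval of `a`, but `a` is missed by left ends and by right ends of hubs
    -- alike.
    both-neighbour : ∀ {a b} → Both a → Cross M a b → b ≡ o ⊎ Neither b
    both-neighbour {a} {b} (ca , ca′) c with chosen⊆ ca | chosen′⊆ ca′
    ... | (pl , unhit) , _ | (_ , unhit′) , _ with plain-neighbour pl c
    ...   | inj₁ b≡o = inj₁ b≡o
    ...   | inj₂ (inj₁ pb) = inj₂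
            ( pb
            , (λ cb → disjoint⇒¬cross (disjoint ca cb (cross⇒≢ c)) c)
            , (λ cb → disjoint⇒¬cross (Piercing.disjoint S′ ca′ cb (cross⇒≢ c)) c))
    ...   | inj₂ (inj₂ hb) with cross⇒end-within c
    ...     | inj₁ x = contradiction (b , hb , x) unhit
    ...     | inj₂ x = contradiction (b , hb , x) unhit′

    -- Every chord of Both has two neighbours in Neither ∪ {o}. Conversely each
    -- end of a chord lies in at most one interval of Both, and the left end of
    -- o lies in none, so 2 |Both| ≤ 2 |Neither| + 1.
    both≤neither : sum (λ i → 𝟙 (both? i)) ≤ sum (λ i → 𝟙 (neither? i))
    both≤neither = halve (begin
      d + d                                          ≡⟨ ∑-distrib-+ 𝟙d 𝟙d ⟨
      sum (λ a → 𝟙d a + 𝟙d a)                        ≤⟨ double-count h h≥ h≤ ⟩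
      sum (λ b → (𝟙ρ b + 𝟙ρ b) + 𝟙 (b ≟ᶠ o))         ≡⟨ ∑-distrib-+ (λ b → 𝟙ρ b + 𝟙ρ b) (λ b → 𝟙 (b ≟ᶠ o)) ⟩
      sum (λ b → 𝟙ρ b + 𝟙ρ b) + sum (λ b → 𝟙 (b ≟ᶠ o)) ≤⟨ +-mono-≤ (≤-reflexive (∑-distrib-+ 𝟙ρ 𝟙ρ))
                                                          (sum-𝟙-unique (_≟ᶠ o) λ { _ _ refl refl → refl }) ⟩
      (ρ + ρ) + 1                                    ∎)
      where
      open ≤-Reasoning
      𝟙d 𝟙ρ : Fin n → ℕ
      𝟙d a = 𝟙 (both? a)
      𝟙ρ b = 𝟙 (neither? b)
      d ρ : ℕ
      d = sum 𝟙d
      ρ = sum 𝟙ρ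

      halve : ∀ {x y} → x + x ≤ (y + y) + 1 → x ≤ y
      halve {x} {y} le with x ≤? y
      ... | yes x≤y = x≤y
      ... | no x≰y  = contradiction le (<⇒≱ (begin-strict
            (y + y) + 1     ≡⟨ +-comm (y + y) 1 ⟩
            suc (y + y)     <⟨ n<1+n _ ⟩
            suc (suc (y + y)) ≡⟨ cong suc (+-suc y y) ⟨
            suc y + suc y   ≤⟨ +-mono-≤ (≰⇒> x≰y) (≰⇒> x≰y) ⟩
            x + x           ∎))

      edge? : ∀ a b → Dec (Both a × Cross M a b)
      edge? a b = both? a ×-dec cross? a b
      h : Fin n → Fin n → ℕ
      h a b = 𝟙 (edge? a b)

      h≥ : ∀ a → 𝟙d a + 𝟙d a ≤ sum (h a)
      h≥ a = 2𝟙≤ (both? a) λ x@(ca , _) →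
        -- A chosen chord is plain, hence branching: `j` and `k` are two distinct neighbours.
        let ((_ , (j , k , j≢k , cj , ck) , _) , _) , _ = chosen⊆ ca in
        ≤-trans (≤-reflexive (cong₂ _+_ (≡-sym (one x cj)) (≡-sym (one x ck)))) (terms≤sum (h a) j≢k)
        where
        2𝟙≤ : {P : Set} (d : Dec P) {m : ℕ} → (P → 2 ≤ m) → 𝟙 d + 𝟙 d ≤ m
        2𝟙≤ (yes p) f = f p
        2𝟙≤ (no _)  f = z≤n
        one : Both a → ∀ {j} → Cross M a j → h a j ≡ 1
        one x c = 𝟙-yes (edge? a _) (x , c)

      end? : ∀ e a → Dec (Both a × Within a e)
      end? e a = both? a ×-dec within? a e

      end≤1 : ∀ e → sum (λ a → 𝟙 (end? e a)) ≤ 1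
      end≤1 e = sum-𝟙-unique (end? e) λ _ _ (x , u) (y , v) → chosen-unique (proj₁ x) (proj₁ y) u v

      h≤ends : ∀ a b → h a b ≤ 𝟙 (end? (l b) a) + 𝟙 (end? (r b) a)
      h≤ends a b with edge? a b
      ... | no _ = z≤n
      ... | yes (x , c) with cross⇒end-within c
      ...   | inj₁ u = ≤-trans (≤-reflexive (≡-sym (𝟙-yes (end? (l b) a) (x , u)))) (m≤m+n _ _)
      ...   | inj₂ u = ≤-trans (≤-reflexive (≡-sym (𝟙-yes (end? (r b) a) (x , u)))) (m≤n+m _ _)

      h≤endₒ : ∀ a → h a o ≤ 𝟙 (end? (r o) a)
      h≤endₒ a = 𝟙-mono (edge? a o) (end? (r o) a) λ where
        (x , inj₁ (la<lo , _)) → contradiction la<lo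
            (<-asym (o-first λ a≡o → proj₁ (proj₁ (proj₁ (chosen⊆ (proj₁ x)))) a≡o))
        (x , inj₂ (_ , u)) → x , u

      h≤ : ∀ b → sum (λ a → h a b) ≤ (𝟙ρ b + 𝟙ρ b) + 𝟙 (b ≟ᶠ o)
      h≤ b with b ≟ᶠ o
      ... | yes refl = ≤-trans (sum-mono h≤endₒ) (≤-trans (end≤1 (r o)) (m≤n+m 1 _))
      ... | no b≢o with neither? b
      ...   | yes _ = begin
              sum (λ a → h a b)                                        ≤⟨ sum-mono (λ a → h≤ends a b) ⟩
              sum (λ a → 𝟙 (end? (l b) a) + 𝟙 (end? (r b) a))          ≡⟨ ∑-distrib-+ (λ a → 𝟙 (end? (l b) a)) (λ a → 𝟙 (end? (r b) a)) ⟩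
              sum (λ a → 𝟙 (end? (l b) a)) + sum (λ a → 𝟙 (end? (r b) a)) ≤⟨ +-mono-≤ (end≤1 (l b)) (end≤1 (r b)) ⟩
              2                                                        ∎
      ...   | no ¬nb = ≤-reflexive (sum-zero λ a → 𝟙-no (edge? a b) λ (x , c) →
              case both-neighbour x c of λ where
                (inj₁ b≡o) → b≢o b≡o
                (inj₂ nb)  → ¬nb nb)

    -- Inclusion and exclusion: summing `pointwise`, the two chosen families together with `Neither`
    -- count at most the plain chords plus `Both`. By `both≤neither` the last term is absorbed by
    -- `Neither`.
    chosen-count : sum (λ i → 𝟙 (chosen? i)) + sum (λ i → 𝟙 (chosen′? i)) ≤ sum (λ i → 𝟙 (plain? i))
    chosen-count = +-cancelʳ-≤ ρ _ _ (begin
      sum 𝟙s + sum 𝟙s′ + ρ                ≡⟨ cong (_+ ρ) (∑-distrib-+ 𝟙s 𝟙s′) ⟨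
      sum (λ i → 𝟙s i + 𝟙s′ i) + ρ        ≡⟨ ∑-distrib-+ (λ i → 𝟙s i + 𝟙s′ i) (λ i → 𝟙 (neither? i)) ⟨
      sum (λ i → 𝟙s i + 𝟙s′ i + 𝟙 (neither? i)) ≤⟨ sum-mono pointwise ⟩
      sum (λ i → 𝟙 (plain? i) + 𝟙 (both? i)) ≡⟨ ∑-distrib-+ (λ i → 𝟙 (plain? i)) (λ i → 𝟙 (both? i)) ⟩
      u + sum (λ i → 𝟙 (both? i))         ≤⟨ +-monoʳ-≤ u both≤neither ⟩
      u + ρ                               ∎)
      where
      open ≤-Reasoning
      𝟙s 𝟙s′ : Fin n → ℕ
      𝟙s i  = 𝟙 (chosen? i)
      𝟙s′ i = 𝟙 (chosen′? i)
      u ρ : ℕ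
      u = sum (λ i → 𝟙 (plain? i))
      ρ = sum (λ i → 𝟙 (neither? i))
      pointwise : ∀ i → 𝟙s i + 𝟙s′ i + 𝟙 (neither? i) ≤ 𝟙 (plain? i) + 𝟙 (both? i)
      pointwise i with plain? i
      ... | no ¬p with chosen? i | chosen′? i
      ...   | yes c | _     = contradiction (proj₁ (proj₁ (chosen⊆ c))) ¬p
      ...   | no _  | yes c = contradiction (proj₁ (proj₁ (chosen′⊆ c))) ¬p
      ...   | no _  | no _  = z≤n
      pointwise i | yes p with chosen? i | chosen′? i
      ...   | yes _ | yes _ = ≤-refl
      ...   | yes _ | no _  = ≤-refl
      ...   | no _  | yes _ = ≤-refl
      ...   | no _  | no _  = ≤-refl

  -- Counting hubs and their leaves.

  HubLeaf : Fin n → Set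
  HubLeaf p = ∃ λ w → w ≢ o × Leaf p w

  abstract
    hubLeaf? : Decidable HubLeaf
    hubLeaf? p = any? λ w → ¬? (w ≟ᶠ o) ×-dec leaf? p w

  -- Every hub has a leaf, and a leaf has only one neighbour, hence only one hub.
  hubs≤leaves : sum (λ i → 𝟙 (hub? i)) ≤ sum (λ i → 𝟙 (hubLeaf? i))
  hubs≤leaves = double-count (λ w p → 𝟙 (e? w p)) e≥ e≤
    where
    e? : ∀ w p → Dec (w ≢ o × Leaf p w)
    e? w p = ¬? (w ≟ᶠ o) ×-dec leaf? p w
    e≥ : ∀ w → 𝟙 (hub? w) ≤ sum (λ p → 𝟙 (e? w p))
    e≥ w with hub? w
    ... | no _ = z≤n
    ... | yes (w≢o , p , lf) =
          ≤-trans (≤-reflexive (≡-sym (𝟙-yes (e? w p) (w≢o , lf)))) (term≤sum (λ p → 𝟙 (e? w p)) p)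
    e≤ : ∀ p → sum (λ w → 𝟙 (e? w p)) ≤ 𝟙 (hubLeaf? p)
    e≤ p with hubLeaf? p
    ... | yes _ = sum-𝟙-unique (λ w → e? w p) λ _ _ (_ , _ , (c , _) , _) (_ , _ , (_ , only) , _) → only _ c
    ... | no ∄w = ≤-reflexive (sum-zero λ w → 𝟙-no (e? w p) λ x → ∄w (w , x))

  -- The three classes are disjoint and avoid `o`; the indicator of `o` accounts for the strict
  -- inequality.
  role-count : sum (λ i → 𝟙 (plain? i)) + sum (λ i → 𝟙 (hub? i)) + sum (λ i → 𝟙 (hubLeaf? i)) < n
  role-count = begin
    suc (sum 𝟙u + sum 𝟙h + sum 𝟙p)                ≡⟨ +-comm 1 _ ⟩
    sum 𝟙u + sum 𝟙h + sum 𝟙p + 1                  ≤⟨ +-monoʳ-≤ (sum 𝟙u + sum 𝟙h + sum 𝟙p)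
                                                      (≤-trans (≤-reflexive (≡-sym (𝟙-yes (o ≟ᶠ o) refl))) (term≤sum 𝟙o o)) ⟩
    sum 𝟙u + sum 𝟙h + sum 𝟙p + sum 𝟙o             ≡⟨ cong (λ x → x + sum 𝟙p + sum 𝟙o) (∑-distrib-+ 𝟙u 𝟙h) ⟨
    sum (λ i → 𝟙u i + 𝟙h i) + sum 𝟙p + sum 𝟙o     ≡⟨ cong (_+ sum 𝟙o) (∑-distrib-+ (λ i → 𝟙u i + 𝟙h i) 𝟙p) ⟨
    sum (λ i → 𝟙u i + 𝟙h i + 𝟙p i) + sum 𝟙o       ≡⟨ ∑-distrib-+ (λ i → 𝟙u i + 𝟙h i + 𝟙p i) 𝟙o ⟨
    sum (λ i → 𝟙u i + 𝟙h i + 𝟙p i + 𝟙o i)         ≤⟨ sum-≤1⇒≤n exclusive ⟩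
    n                                             ∎
    where
    open ≤-Reasoning
    𝟙u 𝟙h 𝟙p 𝟙o : Fin n → ℕ
    𝟙u i = 𝟙 (plain? i)
    𝟙h i = 𝟙 (hub? i)
    𝟙p i = 𝟙 (hubLeaf? i)
    𝟙o i = 𝟙 (i ≟ᶠ o)
    exclusive : ∀ i → 𝟙u i + 𝟙h i + 𝟙p i + 𝟙o i ≤ 1
    exclusive i with plain? i | hub? i | hubLeaf? i | i ≟ᶠ o
    ... | yes (i≢o , _)    | _             | _                   | yes i≡o = contradiction i≡o i≢o
    ... | yes (_ , _ , ¬h) | yes h         | _                   | _       = contradiction h ¬h
    ... | yes (_ , b , _)  | _             | yes (_ , _ , _ , pend , _) | _ = contradiction b (pendant⇒¬branching pend)
    ... | yes _            | no _          | no _                | no _    = ≤-refl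
    ... | no _             | yes (i≢o , _) | _                   | yes i≡o = contradiction i≡o i≢o
    ... | no _             | yes h         | yes (_ , _ , lf)    | _       = contradiction h (leaf⇒¬hub lf)
    ... | no _             | yes _         | no _                | no _    = ≤-refl
    ... | no _             | no _          | yes (_ , _ , i≢o , _) | yes i≡o = contradiction i≡o i≢o
    ... | no _             | no _          | yes _               | no _    = ≤-refl
    ... | no _             | no _          | no _                | yes _   = ≤-refl
    ... | no _             | no _          | no _                | no _    = z≤n

  -- Redrawing the diagram.

  original : ∀ i j → i ≢ j → Placed (l i) (r i) (l j) (r j) (Cross M i j)
  original i j i≢j with distinct M i j i≢j | distinct M j i (≢-sym i≢j)
  ... | li≢lj , ri≢rj , li≢rj | _ , _ , lj≢ri with <-cmp (l i) (l j)
  ...   | tri≈ _ li≡lj _ = contradiction li≡lj li≢lj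
  ...   | tri< li<lj _ _ with <-cmp (l j) (r i)
  ...     | tri≈ _ lj≡ri _ = contradiction lj≡ri lj≢ri
  ...     | tri> _ _ ri<lj = before ri<lj λ where
            (inj₁ (_ , lj<ri , _)) → <-asym lj<ri ri<lj
            (inj₂ (lj<li , _))     → <-asym lj<li li<lj
  ...     | tri< lj<ri _ _ with <-cmp (r i) (r j)
  ...       | tri≈ _ ri≡rj _ = contradiction ri≡rj ri≢rj
  ...       | tri< ri<rj _ _ = crossₗ li<lj lj<ri ri<rj (inj₁ (li<lj , lj<ri , ri<rj))
  ...       | tri> _ _ rj<ri = outside li<lj rj<ri λ where
              (inj₁ (_ , _ , ri<rj)) → <-asym ri<rj rj<ri
              (inj₂ (lj<li , _))     → <-asym lj<li li<lj
  original i j i≢j | li≢lj , ri≢rj , li≢rj | _ , _ , lj≢ri | tri> _ _ lj<li with <-cmp (l i) (r j)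
  ...     | tri≈ _ li≡rj _ = contradiction li≡rj li≢rj
  ...     | tri> _ _ rj<li = after rj<li λ where
            (inj₁ (li<lj , _))     → <-asym lj<li li<lj
            (inj₂ (_ , li<rj , _)) → <-asym li<rj rj<li
  ...     | tri< li<rj _ _ with <-cmp (r i) (r j)
  ...       | tri≈ _ ri≡rj _ = contradiction ri≡rj ri≢rj
  ...       | tri> _ _ rj<ri = crossᵣ lj<li li<rj rj<ri (inj₂ (lj<li , li<rj , rj<ri))
  ...       | tri< ri<rj _ _ = inside lj<li ri<rj λ where
              (inj₁ (li<lj , _))     → <-asym lj<li li<lj
              (inj₂ (_ , _ , rj<ri)) → <-asym ri<rj rj<ri

  -- The redrawn diagram: the end x of the old one becomes a block of K positions
  -- with the end itself in the middle. The leaves of a hub are drawn around its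
  -- tip, which also carries a cut. The wrap-around point serves as the cut of o:
  -- the leaves of o and the isolated chords run around it, and `flipped` tells
  -- on which side of it the first end of o lies.
  module Layout
    -- The left end of `o` may be 0, so its tip has to be the right end: blocks 0 and `top` are kept
    -- for the wrap-around point.
    (leftTip : Fin n → Bool) (leftTip-o : leftTip o ≡ false)
    {T : Fin n → Set} (T? : Decidable T) (hub⊆T : ∀ {w} → Hub w → T w)
    where

    tip : Fin n → ℕ
    tip w = if leftTip w then l w else r w

    -- Offsets in a block: leaves start at offsets less than `n`, offset `n` is free for a cut,
    -- `mid` is the old end, and leaves stop beyond it. All offsets are less than `K`, so blocks do
    -- not overlap; `top` exceeds every old end.
    mid K top : ℕ
    mid = suc n
    K   = suc (mid + mid)
    top = suc (sum r)

    pos : ℕ → ℕ → ℕ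
    pos b x = b * K + x

    -- A cut lies just after its position `c`: it separates `x` from `y` when `x ≤ c < y`. Offset
    -- `mid` thus puts it just inside a left end and offset `n` just inside a right end.
    cut : Fin n → ℕ
    cut t = if leftTip t then pos (l t) mid else pos (r t) n

    -- Opposite monotonicity in `i` nests the leaves of one hub, so that they do not cross.
    below above : Fin n → ℕ
    below i = toℕ i
    above i = mid + (mid ∸ toℕ i)

    -- Petals and isolated chords join block 0 to block `top`. Petals start after `mid` in block 0
    -- and stop before `mid` in block `top`, so on either side they enclose the movable end of `o`
    -- together with the wrap-around point; isolated chords, drawn with `below` and `above`, enclose
    -- that point alone.
    belowₒ aboveₒ : Fin n → ℕ
    belowₒ i = n ∸ toℕ i
    aboveₒ i = suc mid + toℕ i

    block< : ∀ {b b′ x x′} → x < K → b < b′ → pos b x < pos b′ x′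
    block< {b} {b′} {x} {x′} x<K b<b′ = begin-strict
      b * K + x    <⟨ +-monoʳ-< (b * K) x<K ⟩
      b * K + K    ≡⟨ +-comm (b * K) K ⟩
      suc b * K    ≤⟨ *-monoˡ-≤ K b<b′ ⟩
      b′ * K       ≤⟨ m≤m+n _ x′ ⟩
      b′ * K + x′  ∎
      where open ≤-Reasoning

    offset< : ∀ {b x x′} → x < x′ → pos b x < pos b x′
    offset< {b} = +-monoʳ-< (b * K)

    offset≤ : ∀ {b x x′} → x ≤ x′ → pos b x ≤ pos b x′
    offset≤ {b} = +-monoʳ-≤ (b * K)

    mid<K : mid < K
    mid<K = s≤s (m≤m+n mid mid)

    below<mid : ∀ i → below i < mid
    below<mid i = m<n⇒m<1+n (toℕ<n i)

    below<K : ∀ i → below i < K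
    below<K i = <-trans (below<mid i) mid<K

    mid<above : ∀ i → mid < above i
    mid<above i = m<m+n mid (m<n⇒0<n∸m (below<mid i))

    above<K : ∀ i → above i < K
    above<K i = s≤s (+-monoʳ-≤ mid (m∸n≤m mid (toℕ i)))

    belowₒ<mid : ∀ i → belowₒ i < mid
    belowₒ<mid i = s≤s (m∸n≤m n (toℕ i))

    mid<aboveₒ : ∀ i → mid < aboveₒ i
    mid<aboveₒ i = s≤s (m≤m+n mid (toℕ i))

    aboveₒ<K : ∀ i → aboveₒ i < K
    aboveₒ<K i = s≤s (+-monoʳ-< mid (below<mid i))

    above-anti : ∀ {i j} → toℕ i < toℕ j → above j < above i
    above-anti {i} {j} i<j = +-monoʳ-< mid (∸-monoʳ-< i<j (<⇒≤ (below<mid j)))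

    belowₒ-anti : ∀ {i j} → toℕ i < toℕ j → belowₒ j < belowₒ i
    belowₒ-anti {i} {j} i<j = ∸-monoʳ-< i<j (<⇒≤ (toℕ<n j))

    left>0 : ∀ {i} → i ≢ o → 0 < l i
    left>0 i≢o = ≤-<-trans z≤n (o-first i≢o)

    right>0 : ∀ i → 0 < r i
    right>0 i = ≤-<-trans z≤n (left<right M i)

    top>0 : 0 < top
    top>0 = s≤s z≤n

    right<top : ∀ i → r i < top
    right<top i = s≤s (term≤sum r i)

    left<top : ∀ i → l i < top
    left<top i = <-trans (left<right M i) (right<top i)

    tip>0 : ∀ w → 0 < tip w
    tip>0 w with leftTip w in eq
    ... | false = right>0 w
    ... | true  = left>0 λ where refl → case trans (≡-sym eq) leftTip-o of λ ()

    tip<top : ∀ w → tip w < top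
    tip<top w with leftTip w
    ... | false = right<top w
    ... | true  = left<top w

    tip≢left : ∀ {w j} → w ≢ j → tip w ≢ l j
    tip≢left {w} {j} w≢j with leftTip w
    ... | false = ≢-sym (proj₂ (proj₂ (distinct M j w (≢-sym w≢j))))
    ... | true  = proj₁ (distinct M w j w≢j)

    tip≢right : ∀ {w j} → w ≢ j → tip w ≢ r j
    tip≢right {w} {j} w≢j with leftTip w
    ... | false = proj₁ (proj₂ (distinct M w j w≢j))
    ... | true  = proj₂ (proj₂ (distinct M w j w≢j))

    tip≢tip : ∀ {w v} → w ≢ v → tip w ≢ tip v
    tip≢tip {w} {v} w≢v with leftTip v
    ... | false = tip≢right w≢v
    ... | true  = tip≢left w≢v

    tip≤cut : ∀ t → pos (tip t) n ≤ cut t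
    tip≤cut t with leftTip t
    ... | false = ≤-refl
    ... | true  = offset≤ {l t} (n≤1+n n)

    cut≤tip : ∀ t → cut t ≤ pos (tip t) mid
    cut≤tip t with leftTip t
    ... | false = offset≤ {r t} (n≤1+n n)
    ... | true  = ≤-refl

    cut-own : ∀ t → pos (l t) mid ≤ cut t × cut t < pos (r t) mid
    cut-own t with leftTip t
    ... | false = <⇒≤ (block< mid<K (left<right M t)) , offset< {r t} (n<1+n n)
    ... | true  = ≤-refl , block< mid<K (left<right M t)

    cut-within : ∀ {i t} → Within i (tip t) → pos (l i) mid ≤ cut t × cut t < pos (r i) mid
    cut-within {t = t} (li<t , t<ri) =
      ≤-trans (<⇒≤ (block< mid<K li<t)) (tip≤cut t) , ≤-<-trans (cut≤tip t) (block< mid<K t<ri)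

    startₒ endₒ : Bool → ℕ
    startₒ flipped = if flipped then r o else 0
    endₒ   flipped = if flipped then top else r o

    startₒ<endₒ : ∀ f → pos (startₒ f) mid < pos (endₒ f) mid
    startₒ<endₒ false = block< mid<K (right>0 o)
    startₒ<endₒ true  = block< mid<K (right<top o)

    root-iso : ∀ f {j} → (∀ k → ¬ Cross M j k) →
               Placed (pos (startₒ f) mid) (pos (endₒ f) mid) (pos 0 (below j)) (pos top (above j)) (Cross M o j)
    root-iso false {j} alone = inside (offset< {0} (below<mid j)) (block< mid<K (right<top o)) (alone o ∘ swap)
    root-iso true {j} alone = inside (block< (below<K j) (right>0 o)) (offset< {top} (mid<above j)) (alone o ∘ swap)

    root-petal : ∀ f {j} → Leaf j o →
                 Placed (pos (startₒ f) mid) (pos (endₒ f) mid) (pos 0 (aboveₒ j)) (pos top (belowₒ j)) (Cross M o j)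
    root-petal false {j} (_ , (c , _) , _) = crossₗ (offset< {0} (mid<aboveₒ j)) (block< (aboveₒ<K j) (right>0 o))
                         (block< mid<K (right<top o)) (swap c)
    root-petal true {j} (_ , (c , _) , _) = crossᵣ (block< (aboveₒ<K j) (right>0 o)) (block< mid<K (right<top o))
                         (offset< {top} (belowₒ<mid j)) (swap c)

    root-leaf : ∀ f {j w} → w ≢ o → Leaf j w →
                Placed (pos (startₒ f) mid) (pos (endₒ f) mid) (pos (tip w) (below j)) (pos (tip w) (above j)) (Cross M o j)
    root-leaf f {j} {w} w≢o (_ , (_ , only) , _) with f | <-cmp (tip w) (r o)
    ... | _     | tri≈ _ t≡ _ = contradiction t≡ (tip≢right w≢o)
    ... | false | tri< t< _ _ = outside (block< mid<K (tip>0 w)) (block< (above<K j) t<) (w≢o ∘ ≡-sym ∘ only o ∘ swap)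
    ... | true  | tri< t< _ _ = after (block< (above<K j) t<) (w≢o ∘ ≡-sym ∘ only o ∘ swap)
    ... | false | tri> _ _ >t = before (block< mid<K >t) (w≢o ∘ ≡-sym ∘ only o ∘ swap)
    ... | true  | tri> _ _ >t = outside (block< mid<K >t) (block< (above<K j) (tip<top w)) (w≢o ∘ ≡-sym ∘ only o ∘ swap)

    -- Since `o` comes first, only three arrangements remain. Moving its first end across the
    -- wrap-around point complements its interval, which preserves crossings and non-crossings.
    root-core : ∀ f {j} → j ≢ o →
                Placed (pos (startₒ f) mid) (pos (endₒ f) mid) (pos (l j) mid) (pos (r j) mid) (Cross M o j)
    root-core f {j} j≢o with f | original o j (≢-sym j≢o)
    ... | _     | after rj<lo _  = contradiction (<-trans (o-first j≢o) (left<right M j)) (<-asym rj<lo)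
    ... | _     | inside lj<lo _ _ = contradiction (o-first j≢o) (<-asym lj<lo)
    ... | _     | crossᵣ lj<lo _ _ _ = contradiction (o-first j≢o) (<-asym lj<lo)
    ... | false | before x ¬p    = before (block< mid<K x) ¬p
    ... | false | outside _ x ¬p = outside (block< mid<K (left>0 j≢o)) (block< mid<K x) ¬p
    ... | false | crossₗ _ x y p = crossₗ (block< mid<K (left>0 j≢o)) (block< mid<K x) (block< mid<K y) p
    ... | true  | before x ¬p    = outside (block< mid<K x) (block< mid<K (right<top j)) ¬p
    ... | true  | outside _ x ¬p = after (block< mid<K x) ¬p
    ... | true  | crossₗ _ x y p = crossᵣ (block< mid<K x) (block< mid<K y) (block< mid<K (right<top j)) p

    module Drawing (flipped : Bool) where

      Lo Hi : ∀ {i} → Role i → ℕ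
      Lo (root _)           = pos (startₒ flipped) mid
      Lo {i} (iso _ _)      = pos 0 (below i)
      Lo {i} (petal _)      = pos 0 (aboveₒ i)
      Lo {i} (leaf w _ _)   = pos (tip w) (below i)
      Lo {i} (core _ _)     = pos (l i) mid
      Hi (root _)           = pos (endₒ flipped) mid
      Hi {i} (iso _ _)      = pos top (above i)
      Hi {i} (petal _)      = pos top (belowₒ i)
      Hi {i} (leaf w _ _)   = pos (tip w) (above i)
      Hi {i} (core _ _)     = pos (r i) mid

      Lo<Hi : ∀ {i} (ρ : Role i) → Lo ρ < Hi ρ
      Lo<Hi (root _)         = startₒ<endₒ flipped
      Lo<Hi {i} (iso _ _)    = block< (below<K i) top>0
      Lo<Hi {i} (petal _)    = block< (aboveₒ<K i) top>0
      Lo<Hi {i} (leaf w _ _) = offset< {tip w} (<-trans (below<mid i) (mid<above i))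
      Lo<Hi {i} (core _ _)   = block< mid<K (left<right M i)

      Drawn : ∀ {i j} → Role i → Role j → Set
      Drawn {i} {j} ρ σ = Placed (Lo ρ) (Hi ρ) (Lo σ) (Hi σ) (Cross M i j)

      mirror : ∀ {i j} (ρ : Role i) (σ : Role j) → Drawn ρ σ → Drawn σ ρ
      mirror _ _ = Placed-sym swap swap

      iso-iso : ∀ {i j} i≢o x j≢o y → i ≢ j → Drawn {i} {j} (iso i≢o x) (iso j≢o y)
      iso-iso {i} {j} _ alone _ _ i≢j with <-cmp (toℕ i) (toℕ j)
      ... | tri< i<j _ _ = outside (offset< {0} i<j) (offset< {top} (above-anti i<j)) (alone j)
      ... | tri≈ _ i≡j _ = contradiction (toℕ-injective i≡j) i≢j
      ... | tri> _ _ j<i = inside (offset< {0} j<i) (offset< {top} (above-anti j<i)) (alone j)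

      iso-petal : ∀ {i j} i≢o x (lf : Leaf j o) → Drawn {i} (iso i≢o x) (petal lf)
      iso-petal {i} {j} _ alone _ =
        outside (offset< {0} (<-trans (below<mid i) (mid<aboveₒ j)))
                (offset< {top} (<-trans (belowₒ<mid j) (mid<above i))) (alone j)

      iso-leaf : ∀ {i j} i≢o x w w≢o (lf : Leaf j w) → Drawn {i} (iso i≢o x) (leaf w w≢o lf)
      iso-leaf {i} {j} _ alone w _ _ =
        outside (block< (below<K i) (tip>0 w)) (block< (above<K j) (tip<top w)) (alone j)

      iso-core : ∀ {i j} i≢o x j≢o y → Drawn {i} {j} (iso i≢o x) (core j≢o y)
      iso-core {i} {j} _ alone j≢o _ =
        outside (block< (below<K i) (left>0 j≢o)) (block< mid<K (right<top j)) (alone j)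

      petal-petal : ∀ {i j} (lf : Leaf i o) (lf′ : Leaf j o) → i ≢ j → Drawn (petal lf) (petal lf′)
      petal-petal {i} {j} (_ , (_ , only) , _) (j≢o , _) i≢j with <-cmp (toℕ i) (toℕ j)
      ... | tri< i<j _ _ = outside (offset< {0} (+-monoʳ-< (suc mid) i<j))
                                   (offset< {top} (belowₒ-anti i<j)) (j≢o ∘ only j)
      ... | tri≈ _ i≡j _ = contradiction (toℕ-injective i≡j) i≢j
      ... | tri> _ _ j<i = inside (offset< {0} (+-monoʳ-< (suc mid) j<i))
                                  (offset< {top} (belowₒ-anti j<i)) (j≢o ∘ only j)

      petal-leaf : ∀ {i j} (lf : Leaf i o) w w≢o (lf′ : Leaf j w) → Drawn (petal lf) (leaf w w≢o lf′)
      petal-leaf {i} {j} (_ , (_ , only) , _) w _ (j≢o , _) =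
        outside (block< (aboveₒ<K i) (tip>0 w)) (block< (above<K j) (tip<top w)) (j≢o ∘ only j)

      petal-core : ∀ {i j} (lf : Leaf i o) j≢o x → Drawn {j = j} (petal lf) (core j≢o x)
      petal-core {i} {j} (_ , (_ , only) , _) j≢o _ =
        outside (block< (aboveₒ<K i) (left>0 j≢o)) (block< mid<K (right<top j)) (j≢o ∘ only j)

      leaf-leaf : ∀ {i j} w w≢o (lf : Leaf i w) v v≢o (lf′ : Leaf j v) → i ≢ j →
                  Drawn (leaf w w≢o lf) (leaf v v≢o lf′)
      leaf-leaf {i} {j} w w≢o lf@(_ , (_ , only) , _) v v≢o lf′ i≢j = place
        where
        ¬cross : ¬ Cross M i j
        -- Otherwise `j` would be `w`, at once a leaf and a hub.
        ¬cross c with only j c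
        ... | refl = leaf⇒¬hub lf′ (w≢o , i , lf)
        place : Drawn (leaf w w≢o lf) (leaf v v≢o lf′)
        place with w ≟ᶠ v
        place | yes refl with <-cmp (toℕ i) (toℕ j)
        ... | tri< i<j _ _ = outside (offset< {tip w} i<j) (offset< {tip w} (above-anti i<j)) ¬cross
        ... | tri≈ _ i≡j _ = contradiction (toℕ-injective i≡j) i≢j
        ... | tri> _ _ j<i = inside (offset< {tip w} j<i) (offset< {tip w} (above-anti j<i)) ¬cross
        place | no w≢v with <-cmp (tip w) (tip v)
        ... | tri< w<v _ _ = before (block< (above<K i) w<v) ¬cross
        ... | tri≈ _ w≡v _ = contradiction w≡v (tip≢tip w≢v)
        ... | tri> _ _ v<w = after (block< (above<K j) v<w) ¬cross

      -- The block of `tip w` contains an end of the core chord `j` only if `j` is `w`. Then the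
      -- leaf straddles that end and crosses `j`; otherwise no end of `j` falls between the two ends
      -- of the leaf.
      leaf-core : ∀ {i j} w w≢o (lf : Leaf i w) j≢o x → Drawn {j = j} (leaf w w≢o lf) (core j≢o x)
      leaf-core {i} {j} w _ (_ , (c , only) , _) _ _ with w ≟ᶠ j
      ... | yes refl with leftTip w
      ...   | true  = crossₗ (offset< {l w} (below<mid i)) (offset< {l w} (mid<above i))
                             (block< (above<K i) (left<right M w)) c
      ...   | false = crossᵣ (block< mid<K (left<right M w)) (offset< {r w} (below<mid i))
                             (offset< {r w} (mid<above i)) c
      leaf-core {i} {j} w _ (_ , (c , only) , _) _ _ | no w≢j with <-cmp (tip w) (l j) | <-cmp (tip w) (r j)
      ... | tri≈ _ t≡ _ | _ = contradiction t≡ (tip≢left w≢j)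
      ... | tri< t< _ _ | _ = before (block< (above<K i) t<) (≢-sym w≢j ∘ only j)
      ... | tri> _ _ >t | tri< t< _ _ = inside (block< mid<K >t) (block< (above<K i) t<) (≢-sym w≢j ∘ only j)
      ... | tri> _ _ >t | tri≈ _ t≡ _ = contradiction t≡ (tip≢right w≢j)
      ... | tri> _ _ _  | tri> _ _ >t = after (block< mid<K >t) (≢-sym w≢j ∘ only j)

      core-core : ∀ {i j} i≢o x j≢o y → i ≢ j → Drawn {i} {j} (core i≢o x) (core j≢o y)
      core-core {i} {j} _ _ _ _ i≢j with original i j i≢j
      ... | before x ¬p    = before (block< mid<K x) ¬p
      ... | after x ¬p     = after (block< mid<K x) ¬p
      ... | outside x y ¬p = outside (block< mid<K x) (block< mid<K y) ¬p
      ... | inside x y ¬p  = inside (block< mid<K x) (block< mid<K y) ¬p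
      ... | crossₗ x y z p = crossₗ (block< mid<K x) (block< mid<K y) (block< mid<K z) p
      ... | crossᵣ x y z p = crossᵣ (block< mid<K x) (block< mid<K y) (block< mid<K z) p

      drawn : ∀ {i j} (ρ : Role i) (σ : Role j) → i ≢ j → Drawn ρ σ
      drawn (root refl) (root refl) i≢j = contradiction refl i≢j
      drawn (root refl) (iso a b) _ = root-iso flipped b
      drawn (root refl) (petal a) _ = root-petal flipped a
      drawn (root refl) (leaf w a b) _ = root-leaf flipped a b
      drawn (root refl) (core a b) _ = root-core flipped a
      drawn ρ@(iso a b) σ@(root refl) _ = mirror σ ρ (root-iso flipped b)
      drawn (iso a b) (iso c d) i≢j = iso-iso a b c d i≢j
      drawn (iso a b) (petal c) _ = iso-petal a b c
      drawn (iso a b) (leaf w c d) _ = iso-leaf a b w c d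
      drawn (iso a b) (core c d) _ = iso-core a b c d
      drawn ρ@(petal a) σ@(root refl) _ = mirror σ ρ (root-petal flipped a)
      drawn ρ@(petal c) σ@(iso a b) _ = mirror σ ρ (iso-petal a b c)
      drawn (petal a) (petal b) i≢j = petal-petal a b i≢j
      drawn (petal a) (leaf w b c) _ = petal-leaf a w b c
      drawn (petal a) (core b c) _ = petal-core a b c
      drawn ρ@(leaf w a b) σ@(root refl) _ = mirror σ ρ (root-leaf flipped a b)
      drawn ρ@(leaf w c d) σ@(iso a b) _ = mirror σ ρ (iso-leaf a b w c d)
      drawn ρ@(leaf w b c) σ@(petal a) _ = mirror σ ρ (petal-leaf a w b c)
      drawn (leaf w a b) (leaf v c d) i≢j = leaf-leaf w a b v c d i≢j
      drawn (leaf w a b) (core c d) _ = leaf-core w a b c d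
      drawn ρ@(core a b) σ@(root refl) _ = mirror σ ρ (root-core flipped a)
      drawn ρ@(core c d) σ@(iso a b) _ = mirror σ ρ (iso-core a b c d)
      drawn ρ@(core b c) σ@(petal a) _ = mirror σ ρ (petal-core a b c)
      drawn ρ@(core c d) σ@(leaf w a b) _ = mirror σ ρ (leaf-core w a b c d)
      drawn (core a b) (core c d) i≢j = core-core a b c d i≢j

      redrawn : ChordModel n
      redrawn = record
        { left       = λ i → Lo (role i)
        ; right      = λ i → Hi (role i)
        ; left<right = λ i → Lo<Hi (role i)
        ; distinct   = λ i j i≢j → Placed⇒distinct (Lo<Hi (role i)) (Lo<Hi (role j)) (drawn (role i) (role j) i≢j)
        }

      redrawn-represents : ∀ {G : Graph n} → Represents G M → Represents G redrawn
      redrawn-represents rep i j i≢j =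
        (λ a → Placed⇒cross Li<Hi Lj<Hj pl (proj₁ (rep i j i≢j) a)) ,
        (λ c → proj₂ (rep i j i≢j) (cross⇒Placed Li<Hi Lj<Hj pl c))
        where
        Li<Hi = Lo<Hi (role i)
        Lj<Hj = Lo<Hi (role j)
        pl    = drawn (role i) (role j) i≢j

      -- Sides of the polygon.

      passed? : ∀ x t → Dec (T t × cut t < x)
      passed? x t = T? t ×-dec (cut t <? x)

      passed : ℕ → ℕ
      passed x = sum (λ t → 𝟙 (passed? x t))

      -- A side is numbered by the cuts passed before `x`, so there is one side more than there are
      -- elements of `T`.
      side : ℕ → Fin (suc (sum (λ t → 𝟙 (T? t))))
      side x = fromℕ< (s≤s (sum-mono {f = λ t → 𝟙 (passed? x t)} λ t → 𝟙-mono (passed? x t) (T? t) proj₁))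

      toℕ-side : ∀ x → toℕ (side x) ≡ passed x
      toℕ-side x = toℕ-fromℕ< _

      passed-mono : ∀ {x y} → x ≤ y → ∀ t → 𝟙 (passed? x t) ≤ 𝟙 (passed? y t)
      passed-mono {x} {y} x≤y t = 𝟙-mono (passed? x t) (passed? y t) λ (p , q) → p , <-≤-trans q x≤y

      side-mono : ∀ {x y} → x ≤ y → toℕ (side x) ≤ toℕ (side y)
      side-mono {x} {y} x≤y = begin
        toℕ (side x)  ≡⟨ toℕ-side x ⟩
        passed x      ≤⟨ sum-mono (passed-mono x≤y) ⟩
        passed y      ≡⟨ toℕ-side y ⟨
        toℕ (side y)  ∎
        where open ≤-Reasoning

      Separated : ℕ → ℕ → Set
      Separated x y = ∃ λ t → T t × x ≤ cut t × cut t < y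

      side-≢ : ∀ {x y} → Separated x y → side x ≢ side y
      side-≢ {x} {y} (t , Tt , x≤c , c<y) eq = <⇒≢
        -- The cut of `t` is counted for `y` but not for `x`.
        (sum-mono-< (passed-mono (≤-trans x≤c (<⇒≤ c<y))) t
          (subst (_< 𝟙 (passed? y t)) (≡-sym (𝟙-no (passed? x t) λ (_ , c<x) → <⇒≱ c<x x≤c))
            (≤-reflexive (≡-sym (𝟙-yes (passed? y t) (Tt , c<y))))))
        (trans (≡-sym (toℕ-side x)) (trans (cong toℕ eq) (toℕ-side y)))

    module _
      (covered : ∀ {i} → Plain i → ∃ λ t → T t × (t ≡ i ⊎ Within i (tip t)))
      {t₀ : Fin n} (T₀ : T t₀)
      where

      -- Isolated chords and petals reach from block 0 to block `top`, so any cut, here that of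
      -- `t₀`, separates their ends. A leaf uses the cut at the tip of its hub; a core chord uses
      -- its own cut or one at a tip inside its interval.
      separated : ∀ flipped → (let open Drawing flipped) →
                  Separated (pos (startₒ flipped) mid) (pos (endₒ flipped) mid) →
                  ∀ {i} (ρ : Role i) → Separated (Lo ρ) (Hi ρ)
      separated f h (root _) = h
      separated f h {i} (iso _ _) = t₀ , T₀
        , ≤-trans (<⇒≤ (block< (below<K i) (tip>0 t₀))) (tip≤cut t₀)
        , ≤-<-trans (cut≤tip t₀) (block< mid<K (tip<top t₀))
      separated f h {i} (petal _) = t₀ , T₀
        , ≤-trans (<⇒≤ (block< (aboveₒ<K i) (tip>0 t₀))) (tip≤cut t₀)
        , ≤-<-trans (cut≤tip t₀) (block< mid<K (tip<top t₀))
      separated f h {i} (leaf w w≢o lf) = w , hub⊆T (w≢o , i , lf)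
        , ≤-trans (offset≤ {tip w} (<⇒≤ (toℕ<n i))) (tip≤cut w)
        , ≤-<-trans (cut≤tip w) (offset< {tip w} (mid<above i))
      separated f h {i} (core _ (inj₂ hub)) = i , hub⊆T hub , cut-own i
      separated f h {i} (core _ (inj₁ plain)) with covered plain
      ... | t , Tt , inj₁ refl = t , Tt , cut-own t
      ... | t , Tt , inj₂ w    = t , Tt , cut-within w

      -- The cut of `t₀` falls on one side of `r o`, and the first end of `o` is drawn at the far
      -- end of that side.
      root-separated : ∃ λ flipped → (let open Drawing flipped) →
                       Separated (pos (startₒ flipped) mid) (pos (endₒ flipped) mid)
      root-separated with cut t₀ <? pos (r o) mid
      ... | yes c<  = false , t₀ , T₀
                    , ≤-trans (<⇒≤ (block< mid<K (tip>0 t₀))) (tip≤cut t₀) , c<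
      ... | no c≮   = true , t₀ , T₀ , ≮⇒≥ c≮
                    , ≤-<-trans (cut≤tip t₀) (block< mid<K (tip<top t₀))

      polygon : ∀ {G} → Represents G M → IsPolygonGraph (suc (sum (λ t → 𝟙 (T? t)))) G
      polygon {G} rep with root-separated
      ... | f , h = redrawn , redrawn-represents {G} rep , side , side-mono
                  , λ i → side-≢ (separated f h (role i))
        where open Drawing f

  -- Cuts are placed at the hubs and at the chosen chords. Tips agree with `e` on hubs, as the
  -- definition of `Missed` expects, and are right ends elsewhere, where the greedy family pierces.
  polygon-number : (e : Fin n → ℕ) (leftTip : Fin n → Bool) →
                   (∀ {w} → Hub w → (if leftTip w then l w else r w) ≡ e w) →
                   (∀ {i} → ¬ Hub i → leftTip i ≡ false) →
                   (S : Piercing l r (missed? e) (suc (sum r))) →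
                   ∀ {G m} → Represents G M → 2 ≤ m →
                   sum (λ i → 𝟙 (hub? i)) + sum (λ i → 𝟙 (Piercing.chosen? S i)) < m →
                   PolygonNumber≤ G m
  polygon-number e leftTip tip-hub tip-¬hub S {G} {m} rep 2≤m count
    with any? (λ t → hub? t ⊎-dec Piercing.chosen? S t)
  ... | yes (t₀ , T₀) =
        suc (sum 𝟙T)
      , s≤s (≤-trans (≤-reflexive (≡-sym (𝟙-yes (T? t₀) T₀))) (term≤sum 𝟙T t₀))
      , ≤-<-trans 𝟙T≤ count
      , polygon covered T₀ {G} rep
    where
    open Piercing S
    T? : Decidable (λ t → Hub t ⊎ Chosen t)
    T? t = hub? t ⊎-dec chosen? t
    open Layout leftTip (tip-¬hub λ h → proj₁ h refl) T? inj₁ using (tip; polygon)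
    𝟙T : Fin n → ℕ
    𝟙T t = 𝟙 (T? t)
    𝟙⊎ : {P Q : Set} (p : Dec P) (q : Dec Q) → 𝟙 (p ⊎-dec q) ≤ 𝟙 p + 𝟙 q
    𝟙⊎ (yes _) _       = s≤s z≤n
    𝟙⊎ (no _)  (yes _) = ≤-refl
    𝟙⊎ (no _)  (no _)  = z≤n
    𝟙T≤ : sum 𝟙T ≤ sum (λ i → 𝟙 (hub? i)) + sum (λ i → 𝟙 (chosen? i))
    𝟙T≤ = ≤-trans (sum-mono λ i → 𝟙⊎ (hub? i) (chosen? i))
                  (≤-reflexive (∑-distrib-+ (λ i → 𝟙 (hub? i)) (λ i → 𝟙 (chosen? i))))
    tip-chosen : ∀ {a} → Chosen a → tip a ≡ r a
    tip-chosen {a} c rewrite tip-¬hub (proj₂ (proj₂ (proj₁ (proj₁ (chosen⊆ c))))) = refl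
    covered : ∀ {i} → Plain i → ∃ λ t → (Hub t ⊎ Chosen t) × (t ≡ i ⊎ Within i (tip t))
    covered {i} pl with any? (λ w → hub? w ×-dec within? i (e w))
    ... | yes (w , h , wi) = w , inj₁ h , inj₂ (subst (Within i) (≡-sym (tip-hub h)) wi)
    ... | no ∄w with pierced (pl , ∄w) (s≤s (term≤sum r i))
    -- Right ends are distinct, so `r a` lies strictly inside `i` unless `a` is `i` itself.
    ...   | a , c , li<ra , ra≤ri with a ≟ᶠ i
    ...     | yes a≡i = a , inj₂ c , inj₁ a≡i
    ...     | no a≢i  = a , inj₂ c , inj₂ (subst (Within i) (≡-sym (tip-chosen c))
                          (li<ra , ≤∧≢⇒< ra≤ri (proj₁ (proj₂ (distinct M a i a≢i)))))
  -- Without hubs and chosen chords there is no plain chord either, by `pierced`. A single cut at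
  -- `o` then gives two sides, which is where `2 ≤ m` enters.
  ... | no ∄t =
        suc (sum 𝟙o)
      , s≤s (≤-trans (≤-reflexive (≡-sym (𝟙-yes (o ≟ᶠ o) refl))) (term≤sum 𝟙o o))
      , ≤-trans (s≤s (sum-𝟙-unique (_≟ᶠ o) λ { _ _ refl refl → refl })) 2≤m
      , polygon (λ pl → contradiction (_ , inj₂ (proj₁ (proj₂ (pierced (missed pl) (s≤s (term≤sum r _)))))) ∄t)
                refl {G} rep
    where
    open Piercing S
    open Layout leftTip (tip-¬hub λ h → proj₁ h refl) {T = _≡ o} (_≟ᶠ o)
                (λ h → contradiction (_ , inj₁ h) ∄t) using (polygon)
    𝟙o : Fin n → ℕ
    𝟙o i = 𝟙 (i ≟ᶠ o)
    missed : ∀ {i} → Plain i → Missed e i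
    missed pl = pl , λ (w , h , _) → ∄t (w , inj₁ h)

-- Choosing the better orientation.

double<⇒<⌈/2⌉ : ∀ {z n} → z + z < n → z < ⌈ n /2⌉
double<⇒<⌈/2⌉ {z} {n} z+z<n = begin
  suc z                ≡⟨ n≡⌊n+n/2⌋ (suc z) ⟩
  -- `⌈ n /2⌉` is `⌊ suc n /2⌋`, and `z + z < n` gives `suc z + suc z ≤ suc n`.
  ⌊ suc z + suc z /2⌋  ≤⟨ ⌊n/2⌋-mono (s≤s (≤-trans (≤-reflexive (+-suc z z)) z+z<n)) ⟩
  ⌈ n /2⌉              ∎
  where open ≤-Reasoning

smaller-half : ∀ {x y n} → x + y < n → x < ⌈ n /2⌉ ⊎ y < ⌈ n /2⌉
smaller-half {x} {y} {n} x+y<n with ≤-total x y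
... | inj₁ x≤y = inj₁ (double<⇒<⌈/2⌉ (≤-<-trans (+-monoʳ-≤ x x≤y) x+y<n))
... | inj₂ y≤x = inj₂ (double<⇒<⌈/2⌉ (≤-<-trans (+-monoˡ-≤ y y≤x) x+y<n))

theorem4 : (n : ℕ) → 3 ≤ n → (G : Graph n) → IsCircleGraph G →
    PolygonNumber≤ G ⌈ n /2⌉
theorem4 (suc m) 3≤n G (M , rep) = case smaller-half total of λ where
    -- Only hubs turn to the left; a plain chord keeps its right end as tip, where the piercing
    -- takes place.
    (inj₁ few) → polygon-number (left M) (λ w → does (hub? w)) tip-hub (dec-false (hub? _)) S {G} rep 2≤ few
    (inj₂ few) → polygon-number (right M) (λ _ → false) (λ _ → refl) (λ _ → refl) S′ {G} rep 2≤ few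
  where
  o : Fin (suc m)
  o = proj₁ (argmin (left M))
  o-first : ∀ {i} → i ≢ o → left M o < left M i
  o-first {i} i≢o = ≤∧≢⇒< (proj₂ (argmin (left M)) i) (≢-sym (proj₁ (distinct M i o i≢o)))
  open Chords M o o-first
  top : ℕ
  top = suc (sum (right M))
  S : Piercing (left M) (right M) (missed? (left M)) top
  S = pierce (left M) (right M) _ (left<right M) top
  S′ : Piercing (left M) (right M) (missed? (right M)) top
  S′ = pierce (left M) (right M) _ (left<right M) top
  2≤ : 2 ≤ ⌈ suc m /2⌉
  2≤ = ⌈n/2⌉-mono 3≤n
  tip-hub : ∀ {w} → Hub w → (if does (hub? w) then left M w else right M w) ≡ left M w
  tip-hub {w} h rewrite dec-true (hub? w) h = refl
  a s s′ u p : ℕ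
  a  = sum (λ i → 𝟙 (hub? i))
  s  = sum (λ i → 𝟙 (Piercing.chosen? S i))
  s′ = sum (λ i → 𝟙 (Piercing.chosen? S′ i))
  u  = sum (λ i → 𝟙 (plain? i))
  p  = sum (λ i → 𝟙 (hubLeaf? i))
  total : (a + s) + (a + s′) < suc m
  total = begin-strict
    (a + s) + (a + s′)  ≡⟨ rearrange a s s′ ⟩
    -- The second copy of the hub count is traded for the leaves, so that plain chords, hubs and
    -- leaves are counted once each.
    (s + s′) + a + a    ≤⟨ +-mono-≤ (+-monoˡ-≤ a (chosen-count S S′)) hubs≤leaves ⟩
    u + a + p           <⟨ role-count ⟩
    suc m               ∎
    where
    open ≤-Reasoning
    rearrange : ∀ a s s′ → (a + s) + (a + s′) ≡ (s + s′) + a + a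
    rearrange = solve-∀
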